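{- Let $d$ be a positive integer, let $F$ be a Young diagram and let $w\in\{+,-\}^k$ be the type sequence encoding the outer boundary of $F$. (a) For any $d$-RSK growth diagram on $F$, the sequence $\lambda^{(0)},\ldots,\lambda^{(k)}$ of partitions assigned to the lattice points of the outer boundary (listed starting from the point on the positive $x$-axis) is a $d$-semistandard $w$-oscillating tableau, and the filling of the diagram avoids the pattern $d\cdots1(d+1)$. (b) Every filling of $F$ that avoids the pattern $d\cdots1(d+1)$ extends to a unique $d$-RSK growth diagram on $F$. (c) Every $d$-semistandard $w$-oscillating tableau, assigned to the lattice points along the outer boundary of $F$, extends to a unique $d$-RSK growth diagram on $F$. Consequently, there is an explicit bijection between fillings of $F$ avoiding $d\cdots1(d+1)$ and $d$-semistandard $w$-oscillating tableaux.
   Context: Partitions: finite weakly decreasing sequences of positive integers $\lambda=(\lambda_1\ge\cdots\ge\lambda_m)$, with $\lambda_i=0$ for $i>m=\ell(\lambda)$, $|\lambda|=\sum\lambda_i$; $\emptyset$ is the empty partition; a $d$-partition has $\ell(\lambda)\le d$. Write $\alpha\prec\beta$ (equivalently $\beta\succ\alpha$) if $\beta_1\ge\alpha_1\ge\beta_2\ge\alpha_2\ge\cdots$. The Young diagram of a partition lies in the first quadrant with row $i$ (from the bottom) consisting of $\lambda_i$ left-justified unit cells with integer vertices; lattice points are vertices of cells. The outer boundary of a nonempty Young diagram is the lattice path from the positive $x$-axis to the positive $y$-axis along its boundary, made of unit steps up or left; its type sequence $w=w_1\cdots w_k$ has $w_i=+$ if the $i$th step is up and $w_i=-$ if it is left.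 A filling assigns nonnegative integers (entries) to cells. A filling contains the pattern $d\cdots1(d+1)$ if there are $d+1$ cells with nonzero entries such that the first $d$ of them form a se-chain (each cell strictly below and strictly to the right of the previous one) and the last is strictly above and strictly to the right of each of the first $d$; otherwise it avoids the pattern. A $d$-semistandard $w$-oscillating tableau is a sequence of $d$-partitions $\emptyset=\lambda^{(0)},\ldots,\lambda^{(k)}=\emptyset$ with $\lambda^{(i-1)}\prec\lambda^{(i)}$ when $w_i=+$ and $\lambda^{(i-1)}\succ\lambda^{(i)}$ when $w_i=-$. A $d$-RSK growth diagram on $F$ consists of a filling of $F$ and an assignment of a $d$-partition to each lattice point of $F$, with $\emptyset$ on all lattice points on the coordinate axes, such that each cell, with entry $m$ and corner partitions $\kappa$ (bottom-left), $\mu$ (top-left), $\nu$ (bottom-right), $\rho$ (top-right), satisfies: $\mu\succ\kappa\prec\nu$, $\mu\prec\rho\succ\nu$, $m=0$ or $\kappa_d=0$, $\rho_1+\kappa_d=m+\min(\mu_d,\nu_d)+\max(\mu_1,\nu_1)$, and $\rho_i+\kappa_{i-1}=\min(\mu_{i-1},\nu_{i-1})+\max(\mu_i,\nu_i)$ for $2\le i\le d$. -}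

module Defs where

open import Data.Nat using (ℕ; zero; suc; _+_; _∸_; _≤_; _<_; _⊔_; _⊓_)
open import Data.List using (List; []; _∷_; _++_; replicate; map)
open import Data.List.Relation.Unary.All using (All)
open import Data.Vec using (Vec; []; _∷_)
open import Data.Product using (Σ; _×_; _,_; ∃; proj₁; proj₂)
open import Data.Sum using (_⊎_)
open import Data.Empty using (⊥)
open import Data.Unit using (⊤)
open import Relation.Nullary using (¬_)
open import Relation.Binary.PropositionalEquality using (_≡_; _≢_)

-- d-partitions: a d-partition λ is stored as the vector (λ₁,…,λ_d) of
-- its first d parts (padded with zeros).

-- 1-indexed component, with value 0 for index 0 and indices > d
-- (so that λ_i = 0 for i > ℓ(λ), as in the paper).
comp : ∀ {d} → Vec ℕ d → ℕ → ℕ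
comp [] i = 0
comp (x ∷ v) zero = 0
comp (x ∷ v) (suc zero) = x
comp (x ∷ v) (suc (suc i)) = comp v (suc i)

IsDPart : ∀ {d} → Vec ℕ d → Set
IsDPart v = ∀ i → 1 ≤ i → comp v (suc i) ≤ comp v i

emptyP : ∀ d → Vec ℕ d
emptyP zero = []
emptyP (suc d) = 0 ∷ emptyP d

_≺_ : ∀ {d} → Vec ℕ d → Vec ℕ d → Set
α ≺ β = ∀ i → 1 ≤ i → (comp α i ≤ comp β i) × (comp β (suc i) ≤ comp α i)

-- Young diagrams. A Young diagram F is given by its partition, a list of
-- row lengths (bottom row first). Cell (a , b) is the unit square
-- [a,a+1]×[b,b+1] (a = column, b = row, both 0-indexed).

-- 0-indexed row length, 0 beyond the last row
rowLen : List ℕ → ℕ → ℕ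
rowLen [] i = 0
rowLen (r ∷ rs) zero = r
rowLen (r ∷ rs) (suc i) = rowLen rs i

IsYoung : List ℕ → Set
IsYoung F = (F ≢ []) × All (λ r → 1 ≤ r) F × (∀ i → rowLen F (suc i) ≤ rowLen F i)

Point : Set
Point = ℕ × ℕ

InF : List ℕ → Point → Set
InF F (a , b) = a < rowLen F b

Lattice : List ℕ → Point → Set
Lattice F (x , y) = Σ ℕ λ a → Σ ℕ λ b → InF F (a , b) ×
  ((x ≡ a) ⊎ (x ≡ suc a)) × ((y ≡ b) ⊎ (y ≡ suc b))

data Sign : Set where
  up left : Sign     -- up = "+", left = "−"

bdry : List ℕ → List Sign
bdry [] = []
bdry (r ∷ rs) = up ∷ (replicate (r ∸ rowLen rs 0) left ++ bdry rs)

walk : Point → List Sign → List Point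
walk p [] = p ∷ []
walk (x , y) (up ∷ w) = (x , y) ∷ walk (x , suc y) w
walk (x , y) (left ∷ w) = (x , y) ∷ walk (x ∸ 1 , y) w

bdryPoints : List ℕ → List Point
bdryPoints F = walk (rowLen F 0 , 0) (bdry F)

StepRel : ∀ {d} → Sign → Vec ℕ d → Vec ℕ d → Set
StepRel up μ ν = μ ≺ ν
StepRel left μ ν = ν ≺ μ

Chain : ∀ {d} → List Sign → Vec ℕ d → List (Vec ℕ d) → Set
Chain {d} [] μ [] = μ ≡ emptyP d
Chain [] μ (_ ∷ _) = ⊥
Chain (s ∷ w) μ [] = ⊥
Chain (s ∷ w) μ (ν ∷ νs) = IsDPart ν × StepRel s μ ν × Chain w ν νs

IsOscTableau : ∀ d → List Sign → List (Vec ℕ d) → Set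
IsOscTableau d w [] = ⊥
IsOscTableau d w (λ₀ ∷ λs) = (λ₀ ≡ emptyP d) × Chain w λ₀ λs

Filling : Set
Filling = Point → ℕ

Entry : List ℕ → Filling → Point → Set
Entry F f c = InF F c × (f c ≢ 0)

SE : Point → Point → Set
SE (a , b) (a' , b') = (a < a') × (b' < b)

NE : Point → Point → Set
NE (a , b) (a' , b') = (a < a') × (b < b')

Contains : ℕ → List ℕ → Filling → Set
Contains d F f = Σ (ℕ → Point) λ c → Σ Point λ e →
  (∀ i → i < d → Entry F f (c i)) × Entry F f e ×
  (∀ i → suc i < d → SE (c i) (c (suc i))) ×
  (∀ i → i < d → NE (c i) e)

Avoids : ℕ → List ℕ → Filling → Set
Avoids d F f = ¬ Contains d F f

Assignment : ℕ → Set
Assignment d = Point → Vec ℕ d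

-- local rule on a cell with entry m and corners κ (bottom-left),
-- μ (top-left), ν (bottom-right), ρ (top-right)
CellRule : ∀ d → ℕ → Vec ℕ d → Vec ℕ d → Vec ℕ d → Vec ℕ d → Set
CellRule d m κ μ ν ρ =
  (κ ≺ μ) × (κ ≺ ν) × (μ ≺ ρ) × (ν ≺ ρ) ×
  ((m ≡ 0) ⊎ (comp κ d ≡ 0)) ×
  (comp ρ 1 + comp κ d ≡ m + (comp μ d ⊓ comp ν d) + (comp μ 1 ⊔ comp ν 1)) ×
  (∀ i → 2 ≤ i → i ≤ d →
     comp ρ i + comp κ (i ∸ 1)
       ≡ (comp μ (i ∸ 1) ⊓ comp ν (i ∸ 1)) + (comp μ i ⊔ comp ν i))

IsGrowth : ∀ d → List ℕ → Filling → Assignment d → Set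
IsGrowth d F f P =
  (∀ p → Lattice F p → IsDPart (P p)) ×
  (∀ x y → Lattice F (x , y) → (x ≡ 0) ⊎ (y ≡ 0) → P (x , y) ≡ emptyP d) ×
  (∀ a b → InF F (a , b) →
     CellRule d (f (a , b)) (P (a , b)) (P (a , suc b)) (P (suc a , b)) (P (suc a , suc b)))

{-# OPTIONS --safe #-}
module Submission where

-- Each cell rule can be solved for ρ (given m, κ, μ, ν) and, because m = 0 or
-- κ_d = 0, also for (m, κ) (given μ, ν, ρ). Interlacing is preserved both ways,
-- so growth diagrams are built from the axes or from the outer boundary. What
-- remains is that κ_d > 0 exactly when the cells south-west of κ contain an
-- se-chain of d nonzero entries. Until a d-th part appears the rule is that of
-- ordinary RSK, where row 1 is a last-passage time and row k + 1 of f is row k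
-- of the filling `derived f` recording how much of row 1 is bumped in each cell;
-- and, as in Viennot's shadow construction, passing from f to `derived f`
-- shortens the longest se-chain by exactly one.

open import Defs
open import Data.Nat
open import Data.Nat.Properties
open import Data.Fin using (toℕ)
open import Data.List using (List; []; _∷_; map; length; replicate; _++_)
open import Data.List.Properties using (∷-injective)
open import Data.List.Relation.Unary.All using (All; []; _∷_)
open import Data.Vec using (Vec; []; _∷_; tabulate)
open import Data.Product using (Σ; ∃; ∃₂; _×_; _,_; proj₁; proj₂; swap)
open import Data.Sum using (_⊎_; inj₁; inj₂)
open import Data.Unit using (⊤; tt)
open import Function using (_∘_)
open import Relation.Nullary using (yes; no; contradiction)
open import Relation.Binary.PropositionalEquality

-- Last-passage times and the derived filling.

-- The largest sum of entries along an up-right path of cells in columns below `x` and rows below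
-- `y`. The arguments are those of lattice points, so the cell `(x , y)` contributes first at
-- `suc x`, `suc y`.
lastPassage : Filling → ℕ → ℕ → ℕ
lastPassage f zero y = 0
lastPassage f (suc x) zero = 0
lastPassage f (suc x) (suc y) =
  f (x , y) + (lastPassage f x (suc y) ⊔ lastPassage f (suc x) y)

lastPassage-zeroʳ : ∀ f x → lastPassage f x 0 ≡ 0
lastPassage-zeroʳ f zero = refl
lastPassage-zeroʳ f (suc x) = refl

lastPassage-swap : ∀ f x y → lastPassage (f ∘ swap) y x ≡ lastPassage f x y
lastPassage-swap f zero zero = refl
lastPassage-swap f zero (suc y) = refl
lastPassage-swap f (suc x) zero = refl
lastPassage-swap f (suc x) (suc y) = cong (f (x , y) +_)
  (trans (⊔-comm (lastPassage (f ∘ swap) y (suc x)) _)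
         (cong₂ _⊔_ (lastPassage-swap f x (suc y)) (lastPassage-swap f (suc x) y)))

lastPassage-stepˣ : ∀ f x y → lastPassage f x y ≤ lastPassage f (suc x) y
lastPassage-stepˣ f x zero = ≤-reflexive (lastPassage-zeroʳ f x)
lastPassage-stepˣ f x (suc y) =
  ≤-trans (m≤m⊔n _ (lastPassage f (suc x) y)) (m≤n+m _ (f (x , y)))

lastPassage-stepʸ : ∀ f x y → lastPassage f x y ≤ lastPassage f x (suc y)
lastPassage-stepʸ f x y = subst₂ _≤_ (lastPassage-swap f x y) (lastPassage-swap f x (suc y))
  (lastPassage-stepˣ (f ∘ swap) y x)

step⇒mono : (g : ℕ → ℕ) → (∀ n → g n ≤ g (suc n)) → ∀ {m n} → m ≤ n → g m ≤ g n
step⇒mono g step m≤n = go (≤⇒≤′ m≤n)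
  where
  go : ∀ {m n} → m ≤′ n → g m ≤ g n
  go ≤′-refl = ≤-refl
  go (≤′-step p) = ≤-trans (go p) (step _)

lastPassage-monoˣ : ∀ f y {x x'} → x ≤ x' → lastPassage f x y ≤ lastPassage f x' y
lastPassage-monoˣ f y = step⇒mono (λ x → lastPassage f x y) (λ x → lastPassage-stepˣ f x y)

lastPassage-monoʸ : ∀ f x {y y'} → y ≤ y' → lastPassage f x y ≤ lastPassage f x y'
lastPassage-monoʸ f x = step⇒mono (lastPassage f x) (lastPassage-stepʸ f x)

-- The truncation loses nothing, since both terms of the minimum are at least `lastPassage f x y`. A
-- nonzero entry marks a cell where the last-passage time rises strictly along both the left and the
-- bottom edge.
derived : Filling → Filling
derived f (x , y) = (lastPassage f x (suc y) ⊓ lastPassage f (suc x) y) ∸ lastPassage f x y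

derived-swap : ∀ f x y → derived (f ∘ swap) (y , x) ≡ derived f (x , y)
derived-swap f x y = cong₂ _∸_
  (trans (⊓-comm (lastPassage (f ∘ swap) y (suc x)) _)
         (cong₂ _⊓_ (lastPassage-swap f x (suc y)) (lastPassage-swap f (suc x) y)))
  (lastPassage-swap f x y)

derived≢0⇒<ʸ : ∀ f x y → derived f (x , y) ≢ 0 → lastPassage f x y < lastPassage f x (suc y)
derived≢0⇒<ʸ f x y ≢0 = ≤-trans (m∸n≢0⇒n<m ≢0) (m⊓n≤m _ _)

derived≢0⇒<ˣ : ∀ f x y → derived f (x , y) ≢ 0 → lastPassage f x y < lastPassage f (suc x) y
derived≢0⇒<ˣ f x y ≢0 = ≤-trans (m∸n≢0⇒n<m ≢0) (m⊓n≤n (lastPassage f x (suc y)) _)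

entry⇒<ˣ : ∀ f x y → f (x , y) ≢ 0 → lastPassage f x (suc y) < lastPassage f (suc x) (suc y)
entry⇒<ˣ f x y ≢0 = +-mono-≤ (n≢0⇒n>0 ≢0) (m≤m⊔n _ (lastPassage f (suc x) y))

entry⇒<ʸ : ∀ f x y → f (x , y) ≢ 0 → lastPassage f (suc x) y < lastPassage f (suc x) (suc y)
entry⇒<ʸ f x y ≢0 = +-mono-≤ (n≢0⇒n>0 ≢0) (m≤n⊔m (lastPassage f x (suc y)) _)

-- Walk down column `a` from height `b`. At a zero entry the upper-right value is the maximum of the
-- upper-left and the lower-right one; the upper-left one is at most `v`, so the excess over `v`
-- passes down. Either a nonzero entry stops the walk or the excess survives to height `b'`.
column-entry : ∀ f a {b b' v} → b' ≤ b → lastPassage f a b ≤ v → v < lastPassage f (suc a) b →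
  (∃ λ y → b' ≤ y × y < b × f (a , y) ≢ 0) ⊎ v < lastPassage f (suc a) b'
column-entry f a b'≤b = go (≤⇒≤′ b'≤b)
  where
  go : ∀ {b b' v} → b' ≤′ b → lastPassage f a b ≤ v → v < lastPassage f (suc a) b →
       (∃ λ y → b' ≤ y × y < b × f (a , y) ≢ 0) ⊎ v < lastPassage f (suc a) b'
  go ≤′-refl G≤v v<G = inj₂ v<G
  go (≤′-step {n = y} b'≤y) G≤v v<G with f (a , y) in eq
  ... | suc m = inj₁ (y , ≤′⇒≤ b'≤y , ≤-refl , λ z → contradiction (trans (sym eq) z) λ ())
  ... | zero with ⊔-sel (lastPassage f a (suc y)) (lastPassage f (suc a) y)
  ...   | inj₁ e = contradiction (≤-trans v<G (≤-trans (≤-reflexive e) G≤v)) (<-irrefl refl)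
  ...   | inj₂ e with go b'≤y (≤-trans (lastPassage-stepʸ f a y) G≤v)
                         (≤-trans v<G (≤-reflexive e))
  ...     | inj₁ (y' , p , q , r) = inj₁ (y' , p , m≤n⇒m≤1+n q , r)
  ...     | inj₂ v<G' = inj₂ v<G'

row-entry : ∀ f b {a a' v} → a ≤ a' → lastPassage f a' b ≤ v → v < lastPassage f a' (suc b) →
  (∃ λ x → a ≤ x × x < a' × f (x , b) ≢ 0) ⊎ v < lastPassage f a (suc b)
row-entry f b {a} {a'} {v} a≤a' G≤v v<G
  with column-entry (f ∘ swap) b {v = v} a≤a' (subst (_≤ v) (sym (lastPassage-swap f a' b)) G≤v)
         (subst (v <_) (sym (lastPassage-swap f a' (suc b))) v<G)
... | inj₁ r = inj₁ r
... | inj₂ lt = inj₂ (subst (v <_) (lastPassage-swap f a (suc b)) lt)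

-- Walk right along row `b`: by monotonicity the values on the upper side stay above `v`. At a zero
-- derived entry the minimum of the upper-left and lower-right values is at most the lower-left one,
-- so it is the lower-right value that stays at most `v`.
row-derived : ∀ f b {i j v} → i ≤ j → lastPassage f i b ≤ v → v < lastPassage f i (suc b) →
  (∃ λ x → i ≤ x × x < j × derived f (x , b) ≢ 0) ⊎ lastPassage f j b ≤ v
row-derived f b {i} {v = v} i≤j G≤v v<G = go (≤⇒≤′ i≤j)
  where
  go : ∀ {j} → i ≤′ j → (∃ λ x → i ≤ x × x < j × derived f (x , b) ≢ 0) ⊎ lastPassage f j b ≤ v
  go ≤′-refl = inj₂ G≤v
  go (≤′-step {n = k} i≤k) with go i≤k
  ... | inj₁ (x , p , q , r) = inj₁ (x , p , m≤n⇒m≤1+n q , r)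
  ... | inj₂ Gk≤v with derived f (k , b) ≟ 0
  ...   | no ≢0 = inj₁ (k , ≤′⇒≤ i≤k , ≤-refl , ≢0)
  ...   | yes ≡0 with ⊓-sel (lastPassage f k (suc b)) (lastPassage f (suc k) b)
                    | ≤-trans (m∸n≡0⇒m≤n ≡0) Gk≤v
  ...     | inj₂ e | min≤v = inj₂ (subst (_≤ v) e min≤v)
  ...     | inj₁ e | min≤v = contradiction
              (≤-trans (≤-trans v<G (lastPassage-monoˣ f (suc b) (≤′⇒≤ i≤k))) (subst (_≤ v) e min≤v))
              (<-irrefl refl)

column-derived : ∀ f a {i j v} → i ≤ j → lastPassage f a i ≤ v → v < lastPassage f (suc a) i →
  (∃ λ y → i ≤ y × y < j × derived f (a , y) ≢ 0) ⊎ lastPassage f a j ≤ v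
column-derived f a {i} {j} {v} i≤j G≤v v<G
  with row-derived (f ∘ swap) a {v = v} i≤j (subst (_≤ v) (sym (lastPassage-swap f a i)) G≤v)
         (subst (v <_) (sym (lastPassage-swap f (suc a) i)) v<G)
... | inj₁ (y , p , q , r) = inj₁ (y , p , q , λ z → r (trans (derived-swap f a y) z))
... | inj₂ le = inj₂ (subst (_≤ v) (lastPassage-swap f a j) le)

-- Otherwise the last-passage times around the box would strictly increase in
-- a cycle; likewise for derived-between.
entry-between : ∀ f {a b a' b'} → a < a' → b' < b → derived f (a , b) ≢ 0 → derived f (a' , b') ≢ 0 →
  ∃₂ λ x y → a ≤ x × x < a' × b' ≤ y × y < b × f (x , y) ≢ 0
entry-between f {a} {b} {a'} {b'} a<a' b'<b p q
  with column-entry f a (<⇒≤ b'<b) ≤-refl (derived≢0⇒<ˣ f a b p)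
     | row-entry f b' (<⇒≤ a<a') ≤-refl (derived≢0⇒<ʸ f a' b' q)
... | inj₁ (y , b'≤y , y<b , ≢0) | _ = a , y , ≤-refl , a<a' , b'≤y , y<b , ≢0
... | inj₂ _ | inj₁ (x , a≤x , x<a' , ≢0) = x , b' , a≤x , x<a' , ≤-refl , b'<b , ≢0
... | inj₂ lt | inj₂ lt' = contradiction cycle (<-irrefl refl)
  where
  open ≤-Reasoning
  cycle : lastPassage f a b < lastPassage f a b
  cycle = begin-strict
    lastPassage f a b         <⟨ lt ⟩
    lastPassage f (suc a) b'  ≤⟨ lastPassage-monoˣ f b' a<a' ⟩
    lastPassage f a' b'       <⟨ lt' ⟩
    lastPassage f a (suc b')  ≤⟨ lastPassage-monoʸ f a b'<b ⟩
    lastPassage f a b         ∎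

derived-between : ∀ f {a b a' b'} → a < a' → b' < b → f (a , b) ≢ 0 → f (a' , b') ≢ 0 →
  ∃₂ λ x y → a < x × x ≤ a' × b' < y × y ≤ b × derived f (x , y) ≢ 0
derived-between f {a} {b} {a'} {b'} a<a' b'<b p q
  with row-derived f b (m≤n⇒m≤1+n a<a') ≤-refl (entry⇒<ʸ f a b p)
     | column-derived f a' (m≤n⇒m≤1+n b'<b) ≤-refl (entry⇒<ˣ f a' b' q)
... | inj₁ (x , a<x , x≤a' , ≢0) | _ = x , b , a<x , ≤-pred x≤a' , b'<b , ≤-refl , ≢0
... | inj₂ _ | inj₁ (y , b'<y , y≤b , ≢0) = a' , y , a<a' , ≤-refl , b'<y , ≤-pred y≤b , ≢0
... | inj₂ le | inj₂ le' = contradiction cycle (<-irrefl refl)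
  where
  open ≤-Reasoning
  cycle : lastPassage f (suc a) b < lastPassage f (suc a) b
  cycle = begin-strict
    lastPassage f (suc a) b         <⟨ entry⇒<ʸ f a b p ⟩
    lastPassage f (suc a) (suc b)   ≤⟨ lastPassage-monoˣ f (suc b) a<a' ⟩
    lastPassage f a' (suc b)        ≤⟨ le' ⟩
    lastPassage f a' (suc b')       <⟨ entry⇒<ˣ f a' b' q ⟩
    lastPassage f (suc a') (suc b') ≤⟨ lastPassage-monoʸ f (suc a') b'<b ⟩
    lastPassage f (suc a') b        ≤⟨ le ⟩
    lastPassage f (suc a) b         ∎

-- Se-chains in a filling and in its derived filling.

-- An se-chain of k nonzero entries of f in columns l, …, X − 1 and rows below t.
SEChain : Filling → ℕ → ℕ → ℕ → ℕ → Set
SEChain f X zero l t = ⊤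
SEChain f X (suc k) l t = ∃₂ λ a b →
  l ≤ a × a < X × b < t × f (a , b) ≢ 0 × SEChain f X k (suc a) b

SEChain-weaken : ∀ f X k {l l' t t'} → l' ≤ l → t ≤ t' → SEChain f X k l t → SEChain f X k l' t'
SEChain-weaken f X zero l'≤l t≤t' c = tt
SEChain-weaken f X (suc k) l'≤l t≤t' (a , b , l≤a , a<X , b<t , ≢0 , c) =
  a , b , ≤-trans l'≤l l≤a , a<X , ≤-trans b<t t≤t' , ≢0 , c

-- Each pair of consecutive cells of the derived chain has an entry of `f` between them. One more
-- lies to the left of the first cell in its row, and one below the last cell in its column, so the
-- chain in `f` is one longer.
SEChain-lengthen : ∀ f X k {t} → SEChain (derived f) X (suc k) 0 t → SEChain f X (suc (suc k)) 0 t
SEChain-lengthen f X k (a , b , _ , a<X , b<t , ≢0 , c)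
  with row-entry f b z≤n ≤-refl (derived≢0⇒<ʸ f a b ≢0)
... | inj₂ ()
... | inj₁ (x , _ , x<a , ≢0') =
  x , b , z≤n , <-trans x<a a<X , b<t , ≢0' ,
  SEChain-weaken f X (suc k) x<a ≤-refl (go k a b a<X ≢0 c)
  where
  go : ∀ k a b → a < X → derived f (a , b) ≢ 0 → SEChain (derived f) X k (suc a) b →
       SEChain f X (suc k) a b
  go zero a b a<X ≢0 _ with column-entry f a z≤n ≤-refl (derived≢0⇒<ˣ f a b ≢0)
  ... | inj₂ lt = contradiction lt λ ()
  ... | inj₁ (y , _ , y<b , ≢0') = a , y , ≤-refl , a<X , y<b , ≢0' , tt
  go (suc k) a b a<X ≢0 (a' , b' , a<a' , a'<X , b'<b , ≢0' , c)
    with entry-between f a<a' b'<b ≢0 ≢0'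
  ... | x , y , a≤x , x<a' , b'≤y , y<b , e =
    x , y , a≤x , <-trans x<a' a'<X , y<b , e ,
    SEChain-weaken f X (suc k) x<a' b'≤y (go k a' b' a'<X ≢0' c)

-- Each pair of consecutive entries yields a derived entry in the box between them. The boxes are
-- half-open and follow each other to the south-east, so these derived entries again form a chain.
SEChain-shorten : ∀ f X k {t} → SEChain f X (suc k) 0 t → SEChain (derived f) X k 0 t
SEChain-shorten f X k (a , b , _ , a<X , b<t , ≢0 , c) =
  SEChain-weaken (derived f) X k z≤n b<t (go k a b ≢0 c)
  where
  go : ∀ k a b → f (a , b) ≢ 0 → SEChain f X k (suc a) b →
       SEChain (derived f) X k (suc a) (suc b)
  go zero a b ≢0 _ = tt
  go (suc k) a b ≢0 (a' , b' , a<a' , a'<X , b'<b , ≢0' , c)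
    with derived-between f a<a' b'<b ≢0 ≢0'
  ... | x , y , a<x , x≤a' , b'<y , y≤b , e =
    x , y , a<x , ≤-<-trans x≤a' a'<X , s≤s y≤b , e ,
    SEChain-weaken (derived f) X k (s≤s x≤a') b'<y (go k a' b' ≢0' c)

-- Rows of ordinary RSK and chain lengths.

-- The (k+1)-st row of the shapes of the ordinary RSK growth diagram of f.
row : Filling → ℕ → ℕ → ℕ → ℕ
row f zero = lastPassage f
row f (suc k) = row (derived f) k

row-zeroˣ : ∀ f k y → row f k 0 y ≡ 0
row-zeroˣ f zero y = refl
row-zeroˣ f (suc k) y = row-zeroˣ (derived f) k y

row-zeroʸ : ∀ f k x → row f k x 0 ≡ 0
row-zeroʸ f zero x = lastPassage-zeroʳ f x
row-zeroʸ f (suc k) x = row-zeroʸ (derived f) k x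

row-stepˣ : ∀ f k x y → row f k x y ≤ row f k (suc x) y
row-stepˣ f zero = lastPassage-stepˣ f
row-stepˣ f (suc k) = row-stepˣ (derived f) k

row-stepʸ : ∀ f k x y → row f k x y ≤ row f k x (suc y)
row-stepʸ f zero = lastPassage-stepʸ f
row-stepʸ f (suc k) = row-stepʸ (derived f) k

-- The local rule of ordinary RSK beyond the first row: the truncated difference is the amount
-- bumped out of the row before, which is the entry of the filling derived `suc k` times.
row-suc : ∀ f k x y → row f (suc k) (suc x) (suc y) ≡
  ((row f k x (suc y) ⊓ row f k (suc x) y) ∸ row f k x y) +
  (row f (suc k) x (suc y) ⊔ row f (suc k) (suc x) y)
row-suc f zero x y = refl
row-suc f (suc k) x y = row-suc (derived f) k x y

-- Each row passed costs one derivation and adds one cell to the chain. For the first row, tracing a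
-- positive last-passage time back along its recursion reaches a nonzero entry.
row>0⇒SEChain : ∀ f k x y → 0 < row f k x y → SEChain f x (suc k) 0 y
row>0⇒SEChain f (suc k) x y >0 = SEChain-lengthen f x k (row>0⇒SEChain (derived f) k x y >0)
row>0⇒SEChain f zero (suc x) (suc y) >0 with f (x , y) in eq
... | suc m = x , y , z≤n , ≤-refl , ≤-refl , (λ z → contradiction (trans (sym eq) z) λ ()) , tt
... | zero with ⊔-sel (lastPassage f x (suc y)) (lastPassage f (suc x) y)
...   | inj₁ e with row>0⇒SEChain f zero x (suc y) (subst (0 <_) e >0)
...     | a , b , p , q , r , s = a , b , p , m≤n⇒m≤1+n q , r , s
row>0⇒SEChain f zero (suc x) (suc y) >0 | zero | inj₂ e
        with row>0⇒SEChain f zero (suc x) y (subst (0 <_) e >0)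
...     | a , b , p , q , r , s = a , b , p , q , m≤n⇒m≤1+n r , s

SEChain⇒row>0 : ∀ f k x y → SEChain f x (suc k) 0 y → 0 < row f k x y
SEChain⇒row>0 f (suc k) x y c = SEChain⇒row>0 (derived f) k x y (SEChain-shorten f x (suc k) c)
SEChain⇒row>0 f zero x y (a , b , _ , a<x , b<y , ≢0 , _) = begin-strict
  0                             <⟨ n≢0⇒n>0 ≢0 ⟩
  f (a , b)                     ≤⟨ m≤m+n _ _ ⟩
  lastPassage f (suc a) (suc b) ≤⟨ lastPassage-monoˣ f (suc b) a<x ⟩
  lastPassage f x (suc b)       ≤⟨ lastPassage-monoʸ f x b<y ⟩
  lastPassage f x y             ∎
  where open ≤-Reasoning

-- Components of vectors and interlacing.

comp-tabulate : ∀ {d} (h : ℕ → ℕ) i → i < d →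
  comp {d} (tabulate (h ∘ toℕ)) (suc i) ≡ h i
comp-tabulate {suc d} h zero _ = refl
comp-tabulate {suc d} h (suc i) (s≤s i<d) = comp-tabulate {d} (h ∘ suc) i i<d

comp-beyond : ∀ {d} (v : Vec ℕ d) i → d ≤ i → comp v (suc i) ≡ 0
comp-beyond [] i _ = refl
comp-beyond (x ∷ v) (suc i) (s≤s d≤i) = comp-beyond v i d≤i

comp-emptyP : ∀ d i → comp (emptyP d) i ≡ 0
comp-emptyP zero i = refl
comp-emptyP (suc d) zero = refl
comp-emptyP (suc d) (suc zero) = refl
comp-emptyP (suc d) (suc (suc i)) = comp-emptyP d (suc i)

comp-injective : ∀ {d} (u v : Vec ℕ d) → (∀ i → i < d → comp u (suc i) ≡ comp v (suc i)) → u ≡ v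
comp-injective [] [] eq = refl
comp-injective (x ∷ u) (y ∷ v) eq =
  cong₂ _∷_ (eq 0 (s≤s z≤n)) (comp-injective u v (λ i i<d → eq (suc i) (s≤s i<d)))

-- At the remaining indices the smaller side is a component beyond `d`, hence 0.
≺-intro : ∀ {d} (α β : Vec ℕ d) →
  (∀ i → i < d → comp α (suc i) ≤ comp β (suc i)) →
  (∀ i → suc i < d → comp β (suc (suc i)) ≤ comp α (suc i)) → α ≺ β
≺-intro {d} α β h g (suc i) _ = le , ge
  where
  le : comp α (suc i) ≤ comp β (suc i)
  le with i <? d
  ... | yes i<d = h i i<d
  ... | no i≮d = subst (_≤ _) (sym (comp-beyond α i (≮⇒≥ i≮d))) z≤n
  ge : comp β (suc (suc i)) ≤ comp α (suc i)
  ge with suc i <? d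
  ... | yes i<d = g i i<d
  ... | no i≮d = subst (_≤ _) (sym (comp-beyond β (suc i) (≮⇒≥ i≮d))) z≤n

module _ {d} (α β : Vec ℕ d) (α≺β : α ≺ β) where

  ≺-≤ : ∀ i → comp α (suc i) ≤ comp β (suc i)
  ≺-≤ i = proj₁ (α≺β (suc i) (s≤s z≤n))

  ≺-≥ : ∀ i → comp β (suc (suc i)) ≤ comp α (suc i)
  ≺-≥ i = proj₂ (α≺β (suc i) (s≤s z≤n))

  ≺⇒IsDPartˡ : IsDPart α
  ≺⇒IsDPartˡ (suc i) _ = ≤-trans (≺-≤ (suc i)) (≺-≥ i)

  ≺⇒IsDPartʳ : IsDPart β
  ≺⇒IsDPartʳ (suc i) _ = ≤-trans (≺-≥ i) (≺-≤ i)

emptyP-≺ : ∀ d → emptyP d ≺ emptyP d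
emptyP-≺ d i _ = ≤-reflexive (trans (comp-emptyP d i) (sym (comp-emptyP d i))) ,
                 ≤-reflexive (trans (comp-emptyP d (suc i)) (sym (comp-emptyP d i)))

≺-emptyP : ∀ {d} (α : Vec ℕ d) → α ≺ emptyP d → α ≡ emptyP d
≺-emptyP {d} α α≺∅ = comp-injective α (emptyP d) λ i _ →
  trans (n≤0⇒n≡0 (subst (comp α (suc i) ≤_) (comp-emptyP d (suc i)) (≺-≤ α (emptyP d) α≺∅ i)))
        (sym (comp-emptyP d (suc i)))

-- The local rule solved for ρ.

module _ {d} (μ ν : Vec ℕ d) where

  lo hi : ℕ → ℕ
  lo i = comp μ i ⊓ comp ν i
  hi i = comp μ i ⊔ comp ν i

-- The index is zero-based: `growPart m κ μ ν i` is part i + 1 of ρ. What is bumped out of the last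
-- part is recycled into the first, which is where the rule departs from ordinary RSK.
growPart : ∀ {d} → ℕ → (κ μ ν : Vec ℕ d) → ℕ → ℕ
growPart {d} m κ μ ν zero = m + (lo μ ν d ∸ comp κ d) + hi μ ν 1
growPart m κ μ ν (suc i) = (lo μ ν (suc i) ∸ comp κ (suc i)) + hi μ ν (suc (suc i))

grow : ∀ {d} → ℕ → (κ μ ν : Vec ℕ d) → Vec ℕ d
grow m κ μ ν = tabulate (growPart m κ μ ν ∘ toℕ)

comp-grow : ∀ {d} m (κ μ ν : Vec ℕ d) i → i < d → comp (grow m κ μ ν) (suc i) ≡ growPart m κ μ ν i
comp-grow m κ μ ν = comp-tabulate (growPart m κ μ ν)

+∸-cancel : ∀ a {n k} c → k ≤ n → (a + (n ∸ k) + c) + k ≡ a + n + c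
+∸-cancel a {n} {k} c k≤n = begin
  a + (n ∸ k) + c + k   ≡⟨ +-assoc (a + (n ∸ k)) c k ⟩
  a + (n ∸ k) + (c + k) ≡⟨ cong (a + (n ∸ k) +_) (+-comm c k) ⟩
  a + (n ∸ k) + (k + c) ≡⟨ +-assoc (a + (n ∸ k)) k c ⟨
  a + (n ∸ k) + k + c   ≡⟨ cong (_+ c) (+-assoc a (n ∸ k) k) ⟩
  a + (n ∸ k + k) + c   ≡⟨ cong (λ z → a + z + c) (m∸n+n≡m k≤n) ⟩
  a + n + c             ∎
  where open ≡-Reasoning

module _ {d} (κ μ ν : Vec ℕ d) (κ≺μ : κ ≺ μ) (κ≺ν : κ ≺ ν) where

  κ≤lo : ∀ i → comp κ (suc i) ≤ lo μ ν (suc i)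
  κ≤lo i = ⊓-glb (≺-≤ κ μ κ≺μ i) (≺-≤ κ ν κ≺ν i)

  hi≤κ : ∀ i → hi μ ν (suc (suc i)) ≤ comp κ (suc i)
  hi≤κ i = ⊔-lub (≺-≥ κ μ κ≺μ i) (≺-≥ κ ν κ≺ν i)

  growPart-≥hi : ∀ m i → hi μ ν (suc i) ≤ growPart m κ μ ν i
  growPart-≥hi m zero = m≤n+m _ (m + (lo μ ν d ∸ comp κ d))
  growPart-≥hi m (suc i) = m≤n+m _ (lo μ ν (suc i) ∸ comp κ (suc i))

  -- Replacing `hi` by the larger part of κ makes the subtraction cancel. Together with
  -- `growPart-≥hi` this traps each part of ρ as interlacing requires.
  growPart-≤lo : ∀ m i → growPart m κ μ ν (suc i) ≤ lo μ ν (suc i)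
  growPart-≤lo m i = ≤-trans (+-monoʳ-≤ (lo μ ν (suc i) ∸ comp κ (suc i)) (hi≤κ i))
                             (≤-reflexive (m∸n+n≡m (κ≤lo i)))

  ≺-growˡ : ∀ m → μ ≺ grow m κ μ ν
  ≺-growˡ m = ≺-intro μ (grow m κ μ ν)
    (λ i i<d → subst (_ ≤_) (sym (comp-grow m κ μ ν i i<d))
                 (≤-trans (m≤m⊔n (comp μ (suc i)) _) (growPart-≥hi m i)))
    (λ i i<d → subst (_≤ _) (sym (comp-grow m κ μ ν (suc i) i<d))
                 (≤-trans (growPart-≤lo m i) (m⊓n≤m (comp μ (suc i)) _)))

  ≺-growʳ : ∀ m → ν ≺ grow m κ μ ν
  ≺-growʳ m = ≺-intro ν (grow m κ μ ν)
    (λ i i<d → subst (_ ≤_) (sym (comp-grow m κ μ ν i i<d))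
                 (≤-trans (m≤n⊔m (comp μ (suc i)) _) (growPart-≥hi m i)))
    (λ i i<d → subst (_≤ _) (sym (comp-grow m κ μ ν (suc i) i<d))
                 (≤-trans (growPart-≤lo m i) (m⊓n≤n (comp μ (suc i)) _)))

grow-CellRule : ∀ {n} m (κ μ ν : Vec ℕ (suc n)) → κ ≺ μ → κ ≺ ν →
  (m ≡ 0) ⊎ (comp κ (suc n) ≡ 0) → CellRule (suc n) m κ μ ν (grow m κ μ ν)
grow-CellRule {n} m κ μ ν κ≺μ κ≺ν m∨κ =
  κ≺μ , κ≺ν , ≺-growˡ κ μ ν κ≺μ κ≺ν m , ≺-growʳ κ μ ν κ≺μ κ≺ν m , m∨κ ,
  +∸-cancel m (hi μ ν 1) (κ≤lo κ μ ν κ≺μ κ≺ν n) ,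
  λ { (suc zero) (s≤s ()) _
    ; (suc (suc i)) _ (s≤s i<n) →
      trans (cong (_+ comp κ (suc i)) (comp-grow m κ μ ν (suc i) (s≤s i<n)))
            (+∸-cancel 0 (hi μ ν (suc (suc i))) (κ≤lo κ μ ν κ≺μ κ≺ν i)) }

CellRule⇒grow : ∀ {n} m (κ μ ν ρ : Vec ℕ (suc n)) →
  CellRule (suc n) m κ μ ν ρ → ρ ≡ grow m κ μ ν
CellRule⇒grow {n} m κ μ ν ρ (κ≺μ , κ≺ν , _ , _ , _ , eq₁ , eq) =
  comp-injective ρ (grow m κ μ ν) λ
    { zero _ → +-cancelʳ-≡ (comp κ (suc n)) _ _
        (trans eq₁ (sym (+∸-cancel m (hi μ ν 1) (κ≤lo κ μ ν κ≺μ κ≺ν n))))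
    ; (suc i) i<n → trans (+-cancelʳ-≡ (comp κ (suc i)) _ _
        (trans (eq (suc (suc i)) (s≤s (s≤s z≤n)) i<n)
          (sym (+∸-cancel 0 (hi μ ν (suc (suc i))) (κ≤lo κ μ ν κ≺μ κ≺ν i)))))
        (sym (comp-grow m κ μ ν (suc i) i<n)) }

-- The forward growth diagram and its last part.

-- The forward growth diagram of an arbitrary filling of the quadrant: the
-- condition m = 0 or κ_d = 0 may fail, but interlacing never does.
shape : ∀ d → Filling → ℕ → ℕ → Vec ℕ d
shape d f zero y = emptyP d
shape d f (suc x) zero = emptyP d
shape d f (suc x) (suc y) =
  grow (f (x , y)) (shape d f x y) (shape d f x (suc y)) (shape d f (suc x) y)

shape-zeroʳ : ∀ d f x → shape d f x 0 ≡ emptyP d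
shape-zeroʳ d f zero = refl
shape-zeroʳ d f (suc x) = refl

mutual
  shape-≺ˣ : ∀ d f x y → shape d f x y ≺ shape d f (suc x) y
  shape-≺ˣ d f x zero = subst (_≺ emptyP d) (sym (shape-zeroʳ d f x)) (emptyP-≺ d)
  shape-≺ˣ d f x (suc y) = ≺-growˡ (shape d f x y) (shape d f x (suc y)) (shape d f (suc x) y)
    (shape-≺ʸ d f x y) (shape-≺ˣ d f x y) (f (x , y))

  shape-≺ʸ : ∀ d f x y → shape d f x y ≺ shape d f x (suc y)
  shape-≺ʸ d f zero y = emptyP-≺ d
  shape-≺ʸ d f (suc x) y = ≺-growʳ (shape d f x y) (shape d f x (suc y)) (shape d f (suc x) y)
    (shape-≺ʸ d f x y) (shape-≺ˣ d f x y) (f (x , y))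

module _ (n : ℕ) (f : Filling) where

  private
    part : ℕ → ℕ → ℕ → ℕ
    part i x y = comp (shape (suc n) f x y) (suc i)

  -- Once a d-th part has appeared, where d = n + 1, the shapes may differ from those of ordinary
  -- RSK. Beyond that only the positivity of both d-th parts is tracked, and it persists to the
  -- north and east.
  Small Large : ℕ → ℕ → Set
  Small x y = (∀ i → i ≤ n → part i x y ≡ row f i x y) × part n x y ≡ 0
  Large x y = 0 < part n x y × 0 < row f n x y

  Large-stepˣ : ∀ x y → Large x y → Large (suc x) y
  Large-stepˣ x y (p , r) =
    ≤-trans p (≺-≤ (shape (suc n) f x y) (shape (suc n) f (suc x) y) (shape-≺ˣ (suc n) f x y) n) , ≤-trans r (row-stepˣ f n x y)

  Large-stepʸ : ∀ x y → Large x y → Large x (suc y)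
  Large-stepʸ x y (p , r) =
    ≤-trans p (≺-≤ (shape (suc n) f x y) (shape (suc n) f x (suc y)) (shape-≺ʸ (suc n) f x y) n) , ≤-trans r (row-stepʸ f n x y)

  -- As long as no d-th part has appeared there is nothing to recycle into the
  -- first part, so the rule is the one of ordinary RSK.
  Small-cell : ∀ x y → Small x y → Small x (suc y) → Small (suc x) y →
    ∀ i → i ≤ n → part i (suc x) (suc y) ≡ row f i (suc x) (suc y)
  Small-cell x y (κ≡ , κ0) (μ≡ , μ0) (ν≡ , ν0) zero _ = cong₂ _+_
    (trans (cong (f (x , y) +_) (cong₂ _∸_ (cong₂ _⊓_ μ0 ν0) κ0)) (+-identityʳ _))
    (cong₂ _⊔_ (μ≡ 0 z≤n) (ν≡ 0 z≤n))
  Small-cell x y (κ≡ , κ0) (μ≡ , μ0) (ν≡ , ν0) (suc i) i<n = trans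
    (comp-grow (f (x , y)) (shape (suc n) f x y) (shape (suc n) f x (suc y))
       (shape (suc n) f (suc x) y) (suc i) (s≤s i<n))
    (trans (cong₂ _+_
       (cong₂ _∸_ (cong₂ _⊓_ (μ≡ i (<⇒≤ i<n)) (ν≡ i (<⇒≤ i<n))) (κ≡ i (<⇒≤ i<n)))
       (cong₂ _⊔_ (μ≡ (suc i) i<n) (ν≡ (suc i) i<n)))
     (sym (row-suc f i x y)))

  Small-emptyP : ∀ x y → shape (suc n) f x y ≡ emptyP (suc n) → (∀ i → row f i x y ≡ 0) → Small x y
  Small-emptyP x y s≡∅ r≡0 = (λ i _ → trans (p≡0 i) (sym (r≡0 i))) , p≡0 n
    where
    p≡0 : ∀ i → part i x y ≡ 0
    p≡0 i = trans (cong (λ v → comp v (suc i)) s≡∅) (comp-emptyP (suc n) (suc i))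

  -- A `Large` corner makes the north-east corner `Large` by monotonicity. If the other three
  -- corners are `Small`, the cell follows ordinary RSK, so both d-th parts at the new corner are
  -- equal: both zero or both positive.
  Small⊎Large : ∀ x y → Small x y ⊎ Large x y
  Small⊎Large zero y = inj₁ (Small-emptyP zero y refl (λ i → row-zeroˣ f i y))
  Small⊎Large (suc x) zero = inj₁ (Small-emptyP (suc x) zero refl (λ i → row-zeroʸ f i (suc x)))
  Small⊎Large (suc x) (suc y) with Small⊎Large x y | Small⊎Large x (suc y) | Small⊎Large (suc x) y
  ... | _ | inj₂ μ | _ = inj₂ (Large-stepˣ x (suc y) μ)
  ... | _ | _ | inj₂ ν = inj₂ (Large-stepʸ (suc x) y ν)
  ... | inj₂ κ | _ | _ = inj₂ (Large-stepʸ (suc x) y (Large-stepˣ x y κ))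
  ... | inj₁ κ | inj₁ μ | inj₁ ν with part n (suc x) (suc y) ≟ 0
  ...   | yes ρ0 = inj₁ (Small-cell x y κ μ ν , ρ0)
  ...   | no ρ≢0 = inj₂ (n≢0⇒n>0 ρ≢0 ,
            subst (0 <_) (Small-cell x y κ μ ν n ≤-refl) (n≢0⇒n>0 ρ≢0))

  shape-last>0⇒SEChain : ∀ x y → part n x y ≢ 0 → SEChain f x (suc n) 0 y
  shape-last>0⇒SEChain x y ≢0 with Small⊎Large x y
  ... | inj₁ (_ , ≡0) = contradiction ≡0 ≢0
  ... | inj₂ (_ , r) = row>0⇒SEChain f n x y r

  SEChain⇒shape-last>0 : ∀ x y → SEChain f x (suc n) 0 y → part n x y ≢ 0
  SEChain⇒shape-last>0 x y c ≡0 with Small⊎Large x y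
  ... | inj₁ (eq , _) = <-irrefl (trans (sym ≡0) (eq n ≤-refl)) (SEChain⇒row>0 f n x y c)
  ... | inj₂ (p , _) = <-irrefl (sym ≡0) p

-- Se-chains as indexed families of cells.

-- Converts to the form used in `Contains`. The bounds by `X` and `t` are kept for every cell, since
-- they place the whole chain south-west of the last cell of the pattern.
SEChain⇒cells : ∀ f X k {l t} → SEChain f X k l t → Σ (ℕ → Point) λ c →
  (∀ i → i < k → (l ≤ proj₁ (c i) × proj₁ (c i) < X) × proj₂ (c i) < t × f (c i) ≢ 0) ×
  (∀ i → suc i < k → SE (c i) (c (suc i)))
-- The value `0 , 0` is a default for indices past the end of the chain.
SEChain⇒cells f X zero _ = (λ _ → 0 , 0) , (λ _ ()) , (λ _ ())
SEChain⇒cells f X (suc k) {l} {t} (a , b , l≤a , a<X , b<t , ≢0 , rest)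
  with SEChain⇒cells f X k rest
... | c , in-range , se = c' , in-range' , se'
  where
  c' : ℕ → Point
  c' zero = a , b
  c' (suc i) = c i
  in-range' : ∀ i → i < suc k →
    (l ≤ proj₁ (c' i) × proj₁ (c' i) < X) × proj₂ (c' i) < t × f (c' i) ≢ 0
  in-range' zero _ = (l≤a , a<X) , b<t , ≢0
  in-range' (suc i) (s≤s i<k) with in-range i i<k
  ... | (a<c , c<X) , c<b , ≢0' = (≤-trans l≤a (<⇒≤ a<c) , c<X) , <-trans c<b b<t , ≢0'
  se' : ∀ i → suc i < suc k → SE (c' i) (c' (suc i))
  se' zero (s≤s 0<k) with in-range 0 0<k
  ... | (a<c , _) , c<b , _ = a<c , c<b
  se' (suc i) (s≤s i<k) = se i i<k

cells⇒SEChain : ∀ f X k l t (c : ℕ → Point) →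
  (∀ i → i < k → proj₁ (c i) < X × f (c i) ≢ 0) →
  (0 < k → l ≤ proj₁ (c 0) × proj₂ (c 0) < t) →
  (∀ i → suc i < k → SE (c i) (c (suc i))) → SEChain f X k l t
cells⇒SEChain f X zero l t c _ _ _ = tt
cells⇒SEChain f X (suc k) l t c entry first se =
  proj₁ (c 0) , proj₂ (c 0) , proj₁ (first (s≤s z≤n)) , proj₁ (entry 0 (s≤s z≤n)) ,
  proj₂ (first (s≤s z≤n)) , proj₂ (entry 0 (s≤s z≤n)) ,
  cells⇒SEChain f X k _ _ (c ∘ suc) (λ i i<k → entry (suc i) (s≤s i<k))
    (λ 0<k → se 0 (s≤s 0<k)) (λ i i<k → se (suc i) (s≤s i<k))

-- The local rule solved for κ and the entry.

-- Part i + 1 of κ comes from the equation for part i + 2 of ρ, except that the last part is tied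
-- cyclically to the first part of ρ. In that last case the truncation is genuine: a deficit becomes
-- the entry `cellEntry`.
shrinkPart : ∀ {d} → (μ ν ρ : Vec ℕ d) → ℕ → ℕ
shrinkPart {d} μ ν ρ i with suc i ≟ d
... | yes _ = (lo μ ν (suc i) + hi μ ν 1) ∸ comp ρ 1
... | no _ = (lo μ ν (suc i) + hi μ ν (suc (suc i))) ∸ comp ρ (suc (suc i))

shrink : ∀ {d} → (μ ν ρ : Vec ℕ d) → Vec ℕ d
shrink μ ν ρ = tabulate (shrinkPart μ ν ρ ∘ toℕ)

cellEntry : ∀ {d} → (μ ν ρ : Vec ℕ d) → ℕ
cellEntry {d} μ ν ρ = comp ρ 1 ∸ (lo μ ν d + hi μ ν 1)

module _ {n} (μ ν ρ : Vec ℕ (suc n)) where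

  comp-shrink-last : comp (shrink μ ν ρ) (suc n) ≡ (lo μ ν (suc n) + hi μ ν 1) ∸ comp ρ 1
  comp-shrink-last = trans (comp-tabulate (shrinkPart μ ν ρ) n ≤-refl) lemma
    where
    lemma : shrinkPart μ ν ρ n ≡ (lo μ ν (suc n) + hi μ ν 1) ∸ comp ρ 1
    lemma with suc n ≟ suc n
    ... | yes _ = refl
    ... | no ≢ = contradiction refl ≢

  comp-shrink : ∀ i → i < n → comp (shrink μ ν ρ) (suc i) ≡
    (lo μ ν (suc i) + hi μ ν (suc (suc i))) ∸ comp ρ (suc (suc i))
  comp-shrink i i<n = trans (comp-tabulate (shrinkPart μ ν ρ) i (m≤n⇒m≤1+n i<n)) lemma
    where
    lemma : shrinkPart μ ν ρ i ≡ (lo μ ν (suc i) + hi μ ν (suc (suc i))) ∸ comp ρ (suc (suc i))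
    lemma with suc i ≟ suc n
    ... | yes eq = contradiction i<n (<-irrefl (suc-injective eq))
    ... | no _ = refl

-- As k - m = s - a and one of `k`, `m` is zero, they are the positive and the negative part of that
-- difference. This lets a single equation determine both the entry and the last part of κ.
complement : ∀ {a k m} s → a + k ≡ m + s → (m ≡ 0) ⊎ (k ≡ 0) → (k ≡ s ∸ a) × (m ≡ a ∸ s)
complement {a} {k} s eq (inj₁ refl) =
  sym (trans (cong (_∸ a) (sym eq)) (m+n∸m≡n a k)) ,
  sym (m≤n⇒m∸n≡0 (subst (a ≤_) eq (m≤m+n a k)))
complement {a} {m = m} s eq (inj₂ refl) =
  sym (m≤n⇒m∸n≡0 (subst (s ≤_) (trans (sym eq) (+-identityʳ a)) (m≤n+m s m))) ,
  sym (trans (cong (_∸ s) (trans (sym (+-identityʳ a)) eq)) (m+n∸n≡m m s))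

CellRule⇒shrink : ∀ {n} m (κ μ ν ρ : Vec ℕ (suc n)) → CellRule (suc n) m κ μ ν ρ →
  (κ ≡ shrink μ ν ρ) × (m ≡ cellEntry μ ν ρ)
CellRule⇒shrink {n} m κ μ ν ρ (_ , _ , _ , _ , m∨κ , eq₁ , eq) =
  comp-injective κ (shrink μ ν ρ) κ≡ , proj₂ last
  where
  last : (comp κ (suc n) ≡ (lo μ ν (suc n) + hi μ ν 1) ∸ comp ρ 1) × (m ≡ cellEntry μ ν ρ)
  last = complement (lo μ ν (suc n) + hi μ ν 1) (trans eq₁ (+-assoc m _ _)) m∨κ
  κ≡ : ∀ i → i < suc n → comp κ (suc i) ≡ comp (shrink μ ν ρ) (suc i)
  κ≡ i (s≤s i≤n) with m≤n⇒m<n∨m≡n i≤n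
  ... | inj₂ refl = trans (proj₁ last) (sym (comp-shrink-last μ ν ρ))
  ... | inj₁ i<n = trans
    (sym (trans (cong (_∸ comp ρ (suc (suc i))) (sym (eq (suc (suc i)) (s≤s (s≤s z≤n)) (s≤s i<n))))
                (m+n∸m≡n (comp ρ (suc (suc i))) _)))
    (sym (comp-shrink μ ν ρ i i<n))

-- Interlacing with ρ places each part of ρ after the first between `hi` at its own index and `lo`
-- at the index before. Reflecting it in that interval gives a part of κ in the same interval. For
-- the last part of κ the upper bound comes from the first part of ρ.
shrink-CellRule : ∀ {n} (μ ν ρ : Vec ℕ (suc n)) → μ ≺ ρ → ν ≺ ρ →
  CellRule (suc n) (cellEntry μ ν ρ) (shrink μ ν ρ) μ ν ρ
shrink-CellRule {n} μ ν ρ μ≺ρ ν≺ρ =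
  ≺-intro κ μ (λ i i<d → ≤-trans (κ≤lo' i i<d) (m⊓n≤m (comp μ (suc i)) _))
          (λ i i<d → ≤-trans (m≤m⊔n (comp μ (suc (suc i))) _) (hi≤κ' i (≤-pred i<d))) ,
  ≺-intro κ ν (λ i i<d → ≤-trans (κ≤lo' i i<d) (m⊓n≤n (comp μ (suc i)) _))
          (λ i i<d → ≤-trans (m≤n⊔m (comp μ (suc (suc i))) _) (hi≤κ' i (≤-pred i<d))) ,
  μ≺ρ , ν≺ρ , m∨κ , eq₁ , eq
  where
  κ = shrink μ ν ρ
  s = lo μ ν (suc n) + hi μ ν 1
  hi≤ρ : ∀ i → hi μ ν (suc i) ≤ comp ρ (suc i)
  hi≤ρ i = ⊔-lub (≺-≤ μ ρ μ≺ρ i) (≺-≤ ν ρ ν≺ρ i)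
  ρ≤lo : ∀ i → comp ρ (suc (suc i)) ≤ lo μ ν (suc i)
  ρ≤lo i = ⊓-glb (≺-≥ μ ρ μ≺ρ i) (≺-≥ ν ρ ν≺ρ i)
  +∸≤ : ∀ a {b c} → b ≤ c → (a + b) ∸ c ≤ a
  +∸≤ a {b} {c} b≤c = ≤-trans (∸-monoʳ-≤ (a + b) b≤c) (≤-reflexive (m+n∸n≡m a b))
  κ≤lo' : ∀ i → i < suc n → comp κ (suc i) ≤ lo μ ν (suc i)
  κ≤lo' i (s≤s i≤n) with m≤n⇒m<n∨m≡n i≤n
  ... | inj₁ i<n = subst (_≤ _) (sym (comp-shrink μ ν ρ i i<n)) (+∸≤ (lo μ ν (suc i)) (hi≤ρ (suc i)))
  ... | inj₂ refl = subst (_≤ _) (sym (comp-shrink-last μ ν ρ)) (+∸≤ (lo μ ν (suc n)) (hi≤ρ 0))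
  hi≤κ' : ∀ i → i < n → hi μ ν (suc (suc i)) ≤ comp κ (suc i)
  hi≤κ' i i<n = subst (_ ≤_) (sym (comp-shrink μ ν ρ i i<n))
    (≤-trans (≤-reflexive (sym (m+n∸m≡n (lo μ ν (suc i)) _)))
             (∸-monoʳ-≤ (lo μ ν (suc i) + hi μ ν (suc (suc i))) (ρ≤lo i)))
  m∨κ : (cellEntry μ ν ρ ≡ 0) ⊎ (comp κ (suc n) ≡ 0)
  m∨κ with ≤-total (comp ρ 1) s
  ... | inj₁ ρ≤s = inj₁ (m≤n⇒m∸n≡0 ρ≤s)
  ... | inj₂ s≤ρ = inj₂ (trans (comp-shrink-last μ ν ρ) (m≤n⇒m∸n≡0 s≤ρ))
  eq₁ : comp ρ 1 + comp κ (suc n) ≡ cellEntry μ ν ρ + lo μ ν (suc n) + hi μ ν 1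
  eq₁ = trans (cong (comp ρ 1 +_) (comp-shrink-last μ ν ρ))
    (trans lemma (sym (+-assoc (cellEntry μ ν ρ) _ _)))
    where
    -- Both sides are the maximum of `comp ρ 1` and `s`.
    lemma : comp ρ 1 + (s ∸ comp ρ 1) ≡ (comp ρ 1 ∸ s) + s
    lemma with ≤-total (comp ρ 1) s
    ... | inj₁ ρ≤s = trans (m+[n∸m]≡n ρ≤s) (cong (_+ s) (sym (m≤n⇒m∸n≡0 ρ≤s)))
    ... | inj₂ s≤ρ = trans (cong (comp ρ 1 +_) (m≤n⇒m∸n≡0 s≤ρ))
                       (trans (+-identityʳ _) (sym (m∸n+n≡m s≤ρ)))
  eq : ∀ i → 2 ≤ i → i ≤ suc n →
    comp ρ i + comp κ (i ∸ 1) ≡ lo μ ν (i ∸ 1) + hi μ ν i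
  eq (suc (suc i)) _ (s≤s i<n) = trans
    (cong (comp ρ (suc (suc i)) +_) (comp-shrink μ ν ρ i i<n))
    (m+[n∸m]≡n (≤-trans (ρ≤lo i) (m≤m+n _ _)))
  eq (suc zero) (s≤s ())

-- The outer boundary in coordinates.

Decreasing : List ℕ → Set
Decreasing F = ∀ i → rowLen F (suc i) ≤ rowLen F i

rowLen-antitone : ∀ F → Decreasing F → ∀ {i j} → i ≤ j → rowLen F j ≤ rowLen F i
rowLen-antitone F dec i≤j = go (≤⇒≤′ i≤j)
  where
  go : ∀ {i j} → i ≤′ j → rowLen F j ≤ rowLen F i
  go ≤′-refl = ≤-refl
  go (≤′-step p) = ≤-trans (dec _) (go p)

last-row : ∀ F → F ≢ [] → All (1 ≤_) F → ∃ λ j → length F ≡ suc j × 0 < rowLen F j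
last-row [] ≢[] _ = contradiction refl ≢[]
last-row (r ∷ []) _ (p ∷ _) = 0 , refl , p
last-row (r ∷ F@(_ ∷ _)) _ (_ ∷ ps) with last-row F (λ ()) ps
... | j , eq , >0 = suc j , cong suc eq , >0

rowLen-zero⇒length : ∀ F → All (1 ≤_) F → ∀ y → 0 < rowLen F y → rowLen F (suc y) ≡ 0 →
  suc y ≡ length F
rowLen-zero⇒length (r ∷ []) _ zero _ _ = refl
rowLen-zero⇒length (r ∷ r' ∷ F) (_ ∷ s≤s _ ∷ _) zero _ ()
rowLen-zero⇒length (r ∷ F) (_ ∷ ps) (suc y) >0 ≡0 = cong suc (rowLen-zero⇒length F ps y >0 ≡0)

rowLen-length : ∀ F → rowLen F (length F) ≡ 0
rowLen-length [] = refl
rowLen-length (r ∷ F) = rowLen-length F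

next : Sign → Point → Point
next up (x , y) = x , suc y
next left (x , y) = x ∸ 1 , y

-- `walk` without its starting point. Unlike `walk`, it reduces when the sign is a variable.
trail : Point → List Sign → List Point
trail p [] = []
trail p (s ∷ w) = next s p ∷ trail (next s p) w

walk≡trail : ∀ p w → walk p w ≡ p ∷ trail p w
walk≡trail p [] = refl
walk≡trail p (up ∷ w) = cong (p ∷_) (walk≡trail (next up p) w)
walk≡trail p (left ∷ w) = cong (p ∷_) (walk≡trail (next left p) w)

-- General in `R` and `E` because it serves for interlacing along the boundary, for agreement of two
-- assignments and for the increments of a rank.
Along : (Sign → Point → Set) → (Point → Set) → Point → List Sign → Set
Along R E p [] = E p
Along R E p (s ∷ w) = R s p × Along R E (next s p) w

module _ {R : Sign → Point → Set} {E : Point → Set} where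

  Along-lefts : ∀ n x y w → (∀ k → x ≤ k → k < n + x → R left (suc k , y)) →
    Along R E (x , y) w → Along R E (n + x , y) (replicate n left ++ w)
  Along-lefts zero x y w lefts rest = rest
  Along-lefts (suc n) x y w lefts rest = lefts (n + x) (m≤n+m x n) ≤-refl ,
    Along-lefts n x y w (λ k x≤k k<n+x → lefts k x≤k (m≤n⇒m≤1+n k<n+x)) rest

  Along-lefts⁻ : ∀ n x y w → Along R E (n + x , y) (replicate n left ++ w) →
    (∀ k → x ≤ k → k < n + x → R left (suc k , y)) × Along R E (x , y) w
  Along-lefts⁻ zero x y w rest = (λ k x≤k k<x → contradiction (≤-trans k<x x≤k) (<-irrefl refl)) , rest
  Along-lefts⁻ (suc n) x y w (r , rest) with Along-lefts⁻ n x y w rest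
  ... | lefts , rest' = lefts' , rest'
    where
    lefts' : ∀ k → x ≤ k → k < suc n + x → R left (suc k , y)
    lefts' k x≤k (s≤s k≤n+x) with m≤n⇒m<n∨m≡n k≤n+x
    ... | inj₁ k<n+x = lefts k x≤k k<n+x
    ... | inj₂ refl = r

  -- The steps grouped by row: an up step at the right end of row `j`, then left steps along the
  -- part of its top edge not covered by the next row. The offset `y` allows recursion on the
  -- diagram by removing the bottom row.
  OnBoundary : List ℕ → ℕ → Set
  OnBoundary F y =
    (∀ j → 0 < rowLen F j → R up (rowLen F j , y + j)) ×
    (∀ j x → rowLen F (suc j) ≤ x → x < rowLen F j → R left (suc x , suc (y + j))) ×
    E (0 , y + length F)

  Along-bdry : ∀ F y → All (1 ≤_) F → Decreasing F → OnBoundary F y →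
    Along R E (rowLen F 0 , y) (bdry F)
  Along-bdry [] y _ _ (_ , _ , e) = subst (λ z → E (0 , z)) (+-identityʳ y) e
  Along-bdry (r ∷ F) y (1≤r ∷ ps) dec (ups , lefts , e) =
    subst (λ z → R up (r , z)) (+-identityʳ y) (ups 0 1≤r) ,
    subst (λ z → Along R E (z , suc y) (replicate (r ∸ rowLen F 0) left ++ bdry F))
      (m∸n+n≡m (dec 0))
      (Along-lefts (r ∸ rowLen F 0) (rowLen F 0) (suc y) (bdry F)
        (λ k ≤k k< → subst (λ z → R left (suc k , suc z)) (+-identityʳ y)
          (lefts 0 k ≤k (subst (k <_) (m∸n+n≡m (dec 0)) k<)))
        (Along-bdry F (suc y) ps (λ i → dec (suc i))
          ( (λ j >0 → subst (λ z → R up (rowLen F j , z)) (+-suc y j) (ups (suc j) >0))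
          , (λ j x ≤x x< → subst (λ z → R left (suc x , suc z)) (+-suc y j) (lefts (suc j) x ≤x x<))
          , subst (λ z → E (0 , z)) (+-suc y (length F)) e)))

  Along-bdry⁻ : ∀ F y → Decreasing F → Along R E (rowLen F 0 , y) (bdry F) → OnBoundary F y
  Along-bdry⁻ [] y _ e = (λ _ ()) , (λ _ _ _ ()) , subst (λ z → E (0 , z)) (sym (+-identityʳ y)) e
  Along-bdry⁻ (r ∷ F) y dec (u , rest)
    with Along-lefts⁻ (r ∸ rowLen F 0) (rowLen F 0) (suc y) (bdry F)
      (subst (λ z → Along R E (z , suc y) (replicate (r ∸ rowLen F 0) left ++ bdry F))
        (sym (m∸n+n≡m (dec 0))) rest)
  ... | lefts₀ , rest' with Along-bdry⁻ F (suc y) (λ i → dec (suc i)) rest'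
  ...   | ups , lefts , e =
    (λ { zero _ → subst (λ z → R up (r , z)) (sym (+-identityʳ y)) u
       ; (suc j) >0 → subst (λ z → R up (rowLen F j , z)) (sym (+-suc y j)) (ups j >0) }) ,
    (λ { zero x ≤x x< → subst (λ z → R left (suc x , suc z)) (sym (+-identityʳ y))
           (lefts₀ x ≤x (subst (x <_) (sym (m∸n+n≡m (dec 0))) x<))
       ; (suc j) x ≤x x< → subst (λ z → R left (suc x , suc z)) (sym (+-suc y j)) (lefts j x ≤x x<) }) ,
    subst (λ z → E (0 , z)) (sym (+-suc y (length F))) e

-- Tableaux along the boundary.

module _ {d : ℕ} where

  StepAt : (Point → Vec ℕ d) → Sign → Point → Set
  StepAt g s p = StepRel s (g p) (g (next s p))

  EmptyAt : (Point → Vec ℕ d) → Point → Set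
  EmptyAt g p = g p ≡ emptyP d

  StepRel⇒IsDPart : ∀ s (μ ν : Vec ℕ d) → StepRel s μ ν → IsDPart ν
  StepRel⇒IsDPart up μ ν = ≺⇒IsDPartʳ μ ν
  StepRel⇒IsDPart left μ ν = ≺⇒IsDPartˡ ν μ

  Along⇒Chain : ∀ (g : Point → Vec ℕ d) p w → Along (StepAt g) (EmptyAt g) p w →
    Chain w (g p) (map g (trail p w))
  Along⇒Chain g p [] e = e
  Along⇒Chain g p (s ∷ w) (r , rest) =
    StepRel⇒IsDPart s (g p) (g (next s p)) r , r , Along⇒Chain g (next s p) w rest

  Chain⇒Along : ∀ (g : Point → Vec ℕ d) p w → Chain w (g p) (map g (trail p w)) →
    Along (StepAt g) (EmptyAt g) p w
  Chain⇒Along g p [] e = e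
  Chain⇒Along g p (s ∷ w) (_ , r , rest) = r , Chain⇒Along g (next s p) w rest

  AgreeAt : (g h : Point → Vec ℕ d) → Sign → Point → Set
  AgreeAt g h s p = (g p ≡ h p) × (g (next s p) ≡ h (next s p))

  Along⇒map-≡ : ∀ (g h : Point → Vec ℕ d) p w →
    Along (AgreeAt g h) (λ p → g p ≡ h p) p w → map g (walk p w) ≡ map h (walk p w)
  Along⇒map-≡ g h p [] e = cong (_∷ []) e
  Along⇒map-≡ g h p (up ∷ w) ((e , _) , rest) = cong₂ _∷_ e (Along⇒map-≡ g h (next up p) w rest)
  Along⇒map-≡ g h p (left ∷ w) ((e , _) , rest) = cong₂ _∷_ e (Along⇒map-≡ g h (next left p) w rest)

  map-≡⇒Along : ∀ (g h : Point → Vec ℕ d) p w → g p ≡ h p →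
    map g (trail p w) ≡ map h (trail p w) → Along (AgreeAt g h) (λ p → g p ≡ h p) p w
  map-≡⇒Along g h p [] e _ = e
  map-≡⇒Along g h p (s ∷ w) e eq with ∷-injective eq
  ... | e' , eq' = (e , e') , map-≡⇒Along g h (next s p) w e' eq'

  entryAt : List (Vec ℕ d) → ℕ → Vec ℕ d
  entryAt [] _ = emptyP d
  entryAt (v ∷ vs) zero = v
  entryAt (v ∷ vs) (suc k) = entryAt vs k

  -- Turns a list into a function on points: as `rank` grows by one at each step, composing with it
  -- spells the list out along the walk. `Chain` guarantees that list and walk have matching
  -- lengths.
  map-rank : ∀ (rank : Point → ℕ) (h : ℕ → Vec ℕ d) p w ν νs → Chain w ν νs →
    Along (λ s p → rank (next s p) ≡ suc (rank p)) (λ _ → ⊤) p w →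
    (∀ k → h (k + rank p) ≡ entryAt (ν ∷ νs) k) → map (h ∘ rank) (walk p w) ≡ ν ∷ νs
  map-rank rank h p [] ν [] _ _ eq = cong (_∷ []) (eq 0)
  map-rank rank h p (s ∷ w) ν (ν' ∷ νs) (_ , _ , ch) (r , rest) eq =
    trans (walk-map s) (cong₂ _∷_ (eq 0) (map-rank rank h (next s p) w ν' νs ch rest
      (λ k → trans (cong (λ z → h (k + z)) r) (trans (cong h (+-suc k (rank p))) (eq (suc k))))))
    where
    walk-map : ∀ s → map (h ∘ rank) (walk p (s ∷ w)) ≡ h (rank p) ∷ map (h ∘ rank) (walk (next s p) w)
    walk-map up = refl
    walk-map left = refl

-- Induction and recursion from the outer boundary inwards.

-- A cell is treated after its right and upper neighbours, where these lie in the diagram. The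
-- recursion removes the bottom row, and within that row descends on the distance to its right end.
cell-induction : ∀ F (C : ℕ → ℕ → Set) →
  (∀ x y → x < rowLen F y → (suc x < rowLen F y → C (suc x) y) →
     (x < rowLen F (suc y) → C x (suc y)) → C x y) →
  ∀ x y → x < rowLen F y → C x y
cell-induction [] C step x y ()
cell-induction (r ∷ F) C step x (suc y) x<r =
  cell-induction F (λ x y → C x (suc y)) (λ x y → step x (suc y)) x y x<r
cell-induction (r ∷ F) C step x zero x<r = go (r ∸ x) x (m∸n+n≡m (<⇒≤ x<r)) x<r
  where
  go : ∀ n x → n + x ≡ r → x < r → C x 0
  go zero x eq x<r = contradiction x<r (<-irrefl eq)
  go (suc n) x eq x<r = step x 0 x<r
    (go n (suc x) (trans (+-suc n x) eq))
    (cell-induction F (λ x y → C x (suc y)) (λ x y → step x (suc y)) x 0)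

∸-suc : ∀ {m n} → m < n → n ∸ m ≡ suc (n ∸ suc m)
∸-suc {m} {suc n} (s≤s m≤n) = +-∸-assoc 1 m≤n

module _ {d : ℕ} where

  -- The counter is the distance from `x` to the end of the row, which makes the right-to-left
  -- filling structurally recursive.
  fillRow : (top bot : ℕ → Vec ℕ d) → ℕ → ℕ → Vec ℕ d
  fillRow top bot zero x = bot x
  fillRow top bot (suc n) x = shrink (top x) (fillRow top bot n (suc x)) (top (suc x))

  backward : List ℕ → (ℕ → ℕ → Vec ℕ d) → ℕ → ℕ → Vec ℕ d
  backward [] β x y = β x y
  backward (r ∷ F) β x (suc y) = backward F (λ x y → β x (suc y)) x y
  backward (r ∷ F) β x zero =
    fillRow (λ x → backward F (λ x y → β x (suc y)) x 0) (λ x → β x 0) (r ∸ x) x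

  backward-outside : ∀ F β x y → rowLen F y ≤ x → backward F β x y ≡ β x y
  backward-outside [] β x y _ = refl
  backward-outside (r ∷ F) β x (suc y) le = backward-outside F (λ x y → β x (suc y)) x y le
  backward-outside (r ∷ F) β x zero le rewrite m≤n⇒m∸n≡0 le = refl

  backward-inside : ∀ F β x y → x < rowLen F y → backward F β x y ≡
    shrink (backward F β x (suc y)) (backward F β (suc x) y) (backward F β (suc x) (suc y))
  backward-inside (r ∷ F) β x (suc y) lt = backward-inside F (λ x y → β x (suc y)) x y lt
  backward-inside (r ∷ F) β x zero lt rewrite ∸-suc lt = refl

-- The order is κ, ν, μ, ρ, so μ and ν are exchanged relative to `CellRule`.
Corners : (Point → Set) → ℕ → ℕ → Set
Corners K x y = K (x , y) × K (suc x , y) × K (x , suc y) × K (suc x , suc y)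

Lattice⇒Corners : ∀ F (K : Point → Set) → (∀ x y → InF F (x , y) → Corners K x y) →
  ∀ p → Lattice F p → K p
Lattice⇒Corners F K k (x , y) (a , b , inF , x∈ , y∈) with k a b inF | x∈ | y∈
... | κ , ν , μ , ρ | inj₁ refl | inj₁ refl = κ
... | κ , ν , μ , ρ | inj₁ refl | inj₂ refl = μ
... | κ , ν , μ , ρ | inj₂ refl | inj₁ refl = ν
... | κ , ν , μ , ρ | inj₂ refl | inj₂ refl = ρ

cell-corners : ∀ F x y → InF F (x , y) → Corners (Lattice F) x y
cell-corners F x y inF =
  (x , y , inF , inj₁ refl , inj₁ refl) , (x , y , inF , inj₂ refl , inj₁ refl) ,
  (x , y , inF , inj₁ refl , inj₂ refl) , (x , y , inF , inj₂ refl , inj₂ refl)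

CellRule⇒IsDPart : ∀ {d} m (κ μ ν ρ : Vec ℕ d) → CellRule d m κ μ ν ρ →
  IsDPart κ × IsDPart ν × IsDPart μ × IsDPart ρ
CellRule⇒IsDPart m κ μ ν ρ (κ≺μ , κ≺ν , μ≺ρ , ν≺ρ , _) =
  ≺⇒IsDPartˡ κ μ κ≺μ , ≺⇒IsDPartʳ κ ν κ≺ν , ≺⇒IsDPartʳ κ μ κ≺μ , ≺⇒IsDPartʳ μ ρ μ≺ρ

cells⇒IsDPart : ∀ d F (f : Filling) (P : Assignment d) →
  (∀ a b → InF F (a , b) →
     CellRule d (f (a , b)) (P (a , b)) (P (a , suc b)) (P (suc a , b)) (P (suc a , suc b))) →
  ∀ p → Lattice F p → IsDPart (P p)
cells⇒IsDPart d F f P rule = Lattice⇒Corners F (IsDPart ∘ P) λ x y inF →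
  CellRule⇒IsDPart (f (x , y)) (P (x , y)) (P (x , suc y)) (P (suc x , y)) (P (suc x , suc y)) (rule x y inF)

-- Growth diagrams, their boundaries and pattern avoidance.

module _ (n : ℕ) (F : List ℕ) (young : IsYoung F) where

  private
    d = suc n
    nonempty = proj₁ young
    positive = proj₁ (proj₂ young)
    dec = proj₂ (proj₂ young)

  InF-down : ∀ {x y x' y'} → x' ≤ x → y' ≤ y → InF F (x , y) → InF F (x' , y')
  InF-down x'≤x y'≤y inF = ≤-trans (s≤s x'≤x) (≤-trans inF (rowLen-antitone F dec y'≤y))

  -- The cell witnessing the lattice point is weakly north-east of `(x , y)`, and a Young diagram is
  -- closed towards the south-west.
  Lattice⇒InF : ∀ x y → Lattice F (suc x , suc y) → InF F (x , y)
  Lattice⇒InF x y (a , b , inF , x∈ , y∈) = InF-down (pred≤ x∈) (pred≤ y∈) inF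
    where
    pred≤ : ∀ {z a} → (suc z ≡ a) ⊎ (suc z ≡ suc a) → z ≤ a
    pred≤ (inj₁ refl) = n≤1+n _
    pred≤ (inj₂ refl) = ≤-refl

  -- Starting from the axes, each ρ is forced by the entry and the other three corners. This is the
  -- uniqueness for a given filling.
  growth≡shape : ∀ f (P : Assignment d) → IsGrowth d F f P →
    ∀ x y → Lattice F (x , y) → P (x , y) ≡ shape d f x y
  growth≡shape f P (_ , axes , _) zero y lat = axes 0 y lat (inj₁ refl)
  growth≡shape f P (_ , axes , _) (suc x) zero lat = axes (suc x) 0 lat (inj₂ refl)
  growth≡shape f P growth@(_ , _ , rule) (suc x) (suc y) lat
    with cell-corners F x y (Lattice⇒InF x y lat)
  ... | κ∈ , ν∈ , μ∈ , _
    with CellRule⇒grow (f (x , y)) (P (x , y)) (P (x , suc y)) (P (suc x , y)) (P (suc x , suc y))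
           (rule x y (Lattice⇒InF x y lat))
  ... | eq rewrite growth≡shape f P growth x y κ∈ | growth≡shape f P growth x (suc y) μ∈
                 | growth≡shape f P growth (suc x) y ν∈ = eq

  -- Each up step is the right edge of a cell, giving ν ≺ ρ, and each left step is the top edge of a
  -- cell, giving μ ≺ ρ. The end points lie on the axes.
  growth⇒oscillating : ∀ f (P : Assignment d) → IsGrowth d F f P →
    IsOscTableau d (bdry F) (map P (bdryPoints F))
  growth⇒oscillating f P (_ , axes , rule)
    rewrite walk≡trail (rowLen F 0 , 0) (bdry F) =
    axes (rowLen F 0) 0 start∈ (inj₂ refl) ,
    Along⇒Chain P (rowLen F 0 , 0) (bdry F)
      (Along-bdry F 0 positive dec (ups , lefts , axes 0 (length F) end∈ (inj₁ refl)))
    where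
    right∈ : ∀ j → 0 < rowLen F j → Lattice F (rowLen F j , j)
    right∈ j >0 with rowLen F j in eq
    ... | suc r = r , j , subst (r <_) (sym eq) ≤-refl , inj₂ refl , inj₁ refl
    first>0 : 0 < rowLen F 0
    first>0 with last-row F nonempty positive
    ... | j , _ , >0 = ≤-trans >0 (rowLen-antitone F dec z≤n)
    start∈ : Lattice F (rowLen F 0 , 0)
    start∈ = right∈ 0 first>0
    end∈ : Lattice F (0 , length F)
    end∈ with last-row F nonempty positive
    ... | j , eq , >0 = 0 , j , >0 , inj₁ refl , inj₂ eq
    ups : ∀ j → 0 < rowLen F j → StepAt P up (rowLen F j , j)
    ups j >0 with rowLen F j in eq
    ... | suc r with rule r j (subst (r <_) (sym eq) ≤-refl)
    ...   | _ , _ , _ , ν≺ρ , _ = ν≺ρ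
    lefts : ∀ j x → rowLen F (suc j) ≤ x → x < rowLen F j → StepAt P left (suc x , suc j)
    lefts j x _ x< with rule x j x<
    ... | _ , _ , μ≺ρ , _ , _ = μ≺ρ

  -- In the cell that ends a pattern the entry is nonzero, and the d cells of the chain lie
  -- south-west of its κ and force the d-th part of κ to be positive. The local rule excludes this
  -- combination.
  growth⇒avoids : ∀ f (P : Assignment d) → IsGrowth d F f P → Avoids d F f
  growth⇒avoids f P growth@(_ , _ , rule) (c , (a , b) , entries , (e∈ , e≢0) , se , ne)
    with rule a b e∈
  ... | _ , _ , _ , _ , inj₁ m≡0 , _ = e≢0 m≡0
  ... | _ , _ , _ , _ , inj₂ κ≡0 , _ = SEChain⇒shape-last>0 n f a b
    (cells⇒SEChain f a d 0 b c
      (λ i i<d → proj₁ (ne i i<d) , proj₂ (entries i i<d))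
      (λ 0<d → z≤n , proj₂ (ne 0 0<d)) se)
    (trans (cong (λ v → comp v d) (sym (growth≡shape f P growth a b (proj₁ (cell-corners F a b e∈))))) κ≡0)

  avoids⇒growth : ∀ f → Avoids d F f → IsGrowth d F f (λ (x , y) → shape d f x y)
  avoids⇒growth f avoids = cells⇒IsDPart d F f (λ (x , y) → shape d f x y) rule , axes , rule
    where
    axes : ∀ x y → Lattice F (x , y) → (x ≡ 0) ⊎ (y ≡ 0) → shape d f x y ≡ emptyP d
    axes zero y _ _ = refl
    axes (suc x) zero _ _ = refl
    axes (suc x) (suc y) _ (inj₁ ())
    axes (suc x) (suc y) _ (inj₂ ())
    m∨κ : ∀ a b → InF F (a , b) → (f (a , b) ≡ 0) ⊎ (comp (shape d f a b) d ≡ 0)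
    m∨κ a b inF with f (a , b) ≟ 0 | comp (shape d f a b) d ≟ 0
    ... | yes m≡0 | _ = inj₁ m≡0
    ... | no _ | yes κ≡0 = inj₂ κ≡0
    -- A positive d-th part yields an se-chain south-west of the cell, and the cell itself completes
    -- the forbidden pattern.
    ... | no m≢0 | no κ≢0 with SEChain⇒cells f a d (shape-last>0⇒SEChain n f a b κ≢0)
    ...   | c , in-range , se = contradiction
      (c , (a , b) ,
       (λ i i<d → let (_ , c<a) , c<b , ≢0 = in-range i i<d in
         InF-down (<⇒≤ c<a) (<⇒≤ c<b) inF , ≢0) ,
       (inF , m≢0) , se ,
       (λ i i<d → let (_ , c<a) , c<b , _ = in-range i i<d in c<a , c<b))
      avoids
    rule : ∀ a b → InF F (a , b) → CellRule d (f (a , b)) (shape d f a b) (shape d f a (suc b))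
      (shape d f (suc a) b) (shape d f (suc a) (suc b))
    rule a b inF = grow-CellRule (f (a , b)) (shape d f a b) (shape d f a (suc b)) (shape d f (suc a) b)
      (shape-≺ʸ d f a b) (shape-≺ˣ d f a b) (m∨κ a b inF)

  -- The growth diagram determined by a tableau.

  module _ (λ₀ : Vec ℕ d) (λs : List (Vec ℕ d)) (osc : IsOscTableau d (bdry F) (λ₀ ∷ λs)) where

    private
      X = rowLen F 0
      T = λ₀ ∷ λs

      -- The position of a boundary point on the outer boundary.
      rank : Point → ℕ
      rank (x , y) = (X ∸ x) + y

      β : Point → Vec ℕ d
      β = entryAt T ∘ rank

      P : Assignment d
      P (x , y) = backward F (λ x y → β (x , y)) x y

      f : Filling
      f (x , y) = cellEntry (P (x , suc y)) (P (suc x , y)) (P (suc x , suc y))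

    rank-steps : Along (λ s p → rank (next s p) ≡ suc (rank p)) (λ _ → ⊤) (X , 0) (bdry F)
    rank-steps = Along-bdry F 0 positive dec
      ( (λ j _ → +-suc (X ∸ rowLen F j) j)
      , (λ j x _ x< → cong (_+ suc j)
          (∸-suc (≤-trans x< (rowLen-antitone F dec z≤n))))
      , tt)

    map-β : map β (bdryPoints F) ≡ T
    map-β = map-rank rank (entryAt T) (X , 0) (bdry F) λ₀ λs (proj₂ osc) rank-steps
      (λ k → cong (entryAt T) (trans (cong (k +_) (trans (+-identityʳ _) (n∸n≡0 X))) (+-identityʳ k)))

    β-oscillating : (β (X , 0) ≡ emptyP d) × Chain (bdry F) (β (X , 0)) (map β (trail (X , 0) (bdry F)))
    β-oscillating = subst (IsOscTableau d (bdry F))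
      (trans (sym map-β) (cong (map β) (walk≡trail (X , 0) (bdry F)))) osc

    β-boundary : OnBoundary {R = StepAt β} {E = EmptyAt β} F 0
    β-boundary = Along-bdry⁻ F 0 dec (Chain⇒Along β (X , 0) (bdry F) (proj₂ β-oscillating))

    P≡β : ∀ x y → rowLen F y ≤ x → P (x , y) ≡ β (x , y)
    P≡β = backward-outside F (λ x y → β (x , y))

    P-end : P (0 , length F) ≡ emptyP d
    P-end = trans (P≡β 0 (length F) (≤-reflexive (rowLen-length F))) (proj₂ (proj₂ β-boundary))

    map-P : map P (bdryPoints F) ≡ T
    map-P = trans (Along⇒map-≡ P β (X , 0) (bdry F) (Along-bdry F 0 positive dec
      ( (λ j _ → P≡β (rowLen F j) j ≤-refl , P≡β (rowLen F j) (suc j) (dec j))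
      , (λ j x ≤x _ → P≡β (suc x) (suc j) (m≤n⇒m≤1+n ≤x) , P≡β x (suc j) ≤x)
      , P≡β 0 (length F) (≤-reflexive (rowLen-length F))))) map-β

    -- The backward rule requires μ ≺ ρ and ν ≺ ρ. These come from the rules of the upper and the
    -- right neighbour, or from the tableau when the edge in question lies on the outer boundary.
    P-rule : ∀ x y → InF F (x , y) →
      CellRule d (f (x , y)) (P (x , y)) (P (x , suc y)) (P (suc x , y)) (P (suc x , suc y))
    P-rule = cell-induction F _ step
      where
      step : ∀ x y → InF F (x , y) →
        (InF F (suc x , y) → CellRule d (f (suc x , y)) (P (suc x , y)) (P (suc x , suc y))
           (P (suc (suc x) , y)) (P (suc (suc x) , suc y))) →
        (InF F (x , suc y) → CellRule d (f (x , suc y)) (P (x , suc y)) (P (x , suc (suc y)))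
           (P (suc x , suc y)) (P (suc x , suc (suc y)))) →
        CellRule d (f (x , y)) (P (x , y)) (P (x , suc y)) (P (suc x , y)) (P (suc x , suc y))
      step x y inF right above =
        subst (λ κ → CellRule d (f (x , y)) κ (P (x , suc y)) (P (suc x , y)) (P (suc x , suc y)))
          (sym (backward-inside F (λ x y → β (x , y)) x y inF))
          (shrink-CellRule (P (x , suc y)) (P (suc x , y)) (P (suc x , suc y)) μ≺ρ ν≺ρ)
        where
        μ≺ρ : P (x , suc y) ≺ P (suc x , suc y)
        μ≺ρ with x <? rowLen F (suc y)
        ... | yes lt = proj₁ (proj₂ (above lt))
        ... | no ≮ = subst₂ _≺_ (sym (P≡β x (suc y) (≮⇒≥ ≮))) (sym (P≡β (suc x) (suc y) (m≤n⇒m≤1+n (≮⇒≥ ≮))))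
                       (proj₁ (proj₂ β-boundary) y x (≮⇒≥ ≮) inF)
        ν≺ρ : P (suc x , y) ≺ P (suc x , suc y)
        ν≺ρ with m≤n⇒m<n∨m≡n inF
        ... | inj₁ lt = proj₁ (right lt)
        ... | inj₂ eq = subst₂ _≺_ (sym (P≡β (suc x) y (≤-reflexive (sym eq))))
                (sym (P≡β (suc x) (suc y) (≤-trans (dec y) (≤-reflexive (sym eq)))))
                (subst (λ z → β (z , y) ≺ β (z , suc y)) (sym eq)
                  (proj₁ β-boundary y (subst (0 <_) eq (s≤s z≤n))))

    -- The tableau starts with the empty partition, and only the empty partition interlaces below
    -- it, so emptiness spreads leftwards along the axis. The premise `y ≡ 0` confines the cell
    -- induction to the bottom row.
    P-bottom : ∀ x y → InF F (x , y) → y ≡ 0 → EmptyAt P (x , 0) × EmptyAt P (suc x , 0)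
    P-bottom = cell-induction F _ step
      where
      step : ∀ x y → InF F (x , y) →
        (InF F (suc x , y) → y ≡ 0 → EmptyAt P (suc x , 0) × EmptyAt P (suc (suc x) , 0)) →
        (InF F (x , suc y) → suc y ≡ 0 → EmptyAt P (x , 0) × EmptyAt P (suc x , 0)) →
        y ≡ 0 → EmptyAt P (x , 0) × EmptyAt P (suc x , 0)
      step x .0 inF right _ refl = ≺-emptyP (P (x , 0))
        (subst (P (x , 0) ≺_) ν≡∅ (proj₁ (proj₂ (P-rule x 0 inF)))) , ν≡∅
        where
        ν≡∅ : EmptyAt P (suc x , 0)
        ν≡∅ with m≤n⇒m<n∨m≡n inF
        ... | inj₁ lt = proj₁ (right lt refl)
        ... | inj₂ eq = trans (P≡β (suc x) 0 (≤-reflexive (sym eq)))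
                (subst (λ z → β (z , 0) ≡ emptyP d) (sym eq) (proj₁ β-oscillating))

    P-side : ∀ x y → InF F (x , y) → x ≡ 0 → EmptyAt P (0 , y) × EmptyAt P (0 , suc y)
    P-side = cell-induction F _ step
      where
      step : ∀ x y → InF F (x , y) →
        (InF F (suc x , y) → suc x ≡ 0 → EmptyAt P (0 , y) × EmptyAt P (0 , suc y)) →
        (InF F (x , suc y) → x ≡ 0 → EmptyAt P (0 , suc y) × EmptyAt P (0 , suc (suc y))) →
        x ≡ 0 → EmptyAt P (0 , y) × EmptyAt P (0 , suc y)
      step .0 y inF _ above refl = ≺-emptyP (P (0 , y))
        (subst (P (0 , y) ≺_) μ≡∅ (proj₁ (P-rule 0 y inF))) , μ≡∅
        where
        μ≡∅ : EmptyAt P (0 , suc y)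
        μ≡∅ with 0 <? rowLen F (suc y)
        ... | yes lt = proj₁ (above lt refl)
        -- The cell lies in the topmost row, so its upper-left corner is the end of the boundary.
        ... | no ≮ = subst (λ z → P (0 , z) ≡ emptyP d)
                (sym (rowLen-zero⇒length F positive y inF (n≤0⇒n≡0 (≮⇒≥ ≮)))) P-end

    P-axes : ∀ x y → Lattice F (x , y) → (x ≡ 0) ⊎ (y ≡ 0) → P (x , y) ≡ emptyP d
    P-axes .0 y (.0 , .y , inF , inj₁ refl , inj₁ refl) (inj₁ refl) = proj₁ (P-side 0 y inF refl)
    P-axes .0 .(suc b) (.0 , b , inF , inj₁ refl , inj₂ refl) (inj₁ refl) = proj₂ (P-side 0 b inF refl)
    P-axes x .0 (.x , .0 , inF , inj₁ refl , inj₁ refl) (inj₂ refl) = proj₁ (P-bottom x 0 inF refl)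
    P-axes .(suc a) .0 (a , .0 , inF , inj₂ refl , inj₁ refl) (inj₂ refl) = proj₂ (P-bottom a 0 inF refl)

    P-growth : IsGrowth d F f P
    P-growth = cells⇒IsDPart d F f P P-rule , P-axes , P-rule

    module _ (f' : Filling) (P' : Assignment d) (growth' : IsGrowth d F f' P')
             (map-P' : map P' (bdryPoints F) ≡ T) where

      private
        rule' = proj₂ (proj₂ growth')

        Same : Point → Set
        Same p = P' p ≡ P p

      P'-boundary : OnBoundary {R = AgreeAt P' P} {E = Same} F 0
      P'-boundary = Along-bdry⁻ F 0 dec (map-≡⇒Along P' P (X , 0) (bdry F) (proj₁ eqs) (proj₂ eqs))
        where
        eqs = ∷-injective (trans (cong (map P') (sym (walk≡trail (X , 0) (bdry F))))
          (trans map-P' (trans (sym map-P) (cong (map P) (walk≡trail (X , 0) (bdry F))))))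

      -- Agreement spreads inwards: μ, ν and ρ agree through neighbouring cells or through the
      -- boundary, and the backward rule then forces κ.
      same-corners : ∀ x y → InF F (x , y) → Corners Same x y
      same-corners = cell-induction F (Corners Same) step
        where
        step : ∀ x y → InF F (x , y) → (InF F (suc x , y) → Corners Same (suc x) y) →
          (InF F (x , suc y) → Corners Same x (suc y)) → Corners Same x y
        step x y inF right above = κ≡ , proj₁ νρ≡ , μ≡ , proj₂ νρ≡
          where
          μ≡ : Same (x , suc y)
          μ≡ with x <? rowLen F (suc y)
          ... | yes lt = proj₁ (above lt)
          ... | no ≮ = proj₂ (proj₁ (proj₂ P'-boundary) y x (≮⇒≥ ≮) inF)
          νρ≡ : Same (suc x , y) × Same (suc x , suc y)
          νρ≡ with m≤n⇒m<n∨m≡n inF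
          ... | inj₁ lt = let κ , _ , μ , _ = right lt in κ , μ
          ... | inj₂ eq = subst (λ z → Same (z , y) × Same (z , suc y)) (sym eq)
                  (proj₁ P'-boundary y (subst (0 <_) eq (s≤s z≤n)))
          κ≡ : Same (x , y)
          κ≡ = begin
            P' (x , y)
              ≡⟨ proj₁ (CellRule⇒shrink (f' (x , y)) (P' (x , y)) (P' (x , suc y)) (P' (suc x , y))
                   (P' (suc x , suc y)) (rule' x y inF)) ⟩
            shrink (P' (x , suc y)) (P' (suc x , y)) (P' (suc x , suc y))
              ≡⟨ cong₂ (λ μ (ν , ρ) → shrink μ ν ρ) μ≡ (cong₂ _,_ (proj₁ νρ≡) (proj₂ νρ≡)) ⟩
            shrink (P (x , suc y)) (P (suc x , y)) (P (suc x , suc y))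
              ≡⟨ backward-inside F (λ x y → β (x , y)) x y inF ⟨
            P (x , y) ∎
            where open ≡-Reasoning

      same-entry : ∀ c → InF F c → f' c ≡ f c
      same-entry (x , y) inF with same-corners x y inF
      ... | _ , ν≡ , μ≡ , ρ≡ = trans
        (proj₂ (CellRule⇒shrink (f' (x , y)) (P' (x , y)) (P' (x , suc y)) (P' (suc x , y))
                   (P' (suc x , suc y)) (rule' x y inF)))
        (cong₂ (λ μ (ν , ρ) → cellEntry μ ν ρ) μ≡ (cong₂ _,_ ν≡ ρ≡))

    oscillating⇒growth : Σ Filling λ f → Σ (Assignment d) λ P →
      (IsGrowth d F f P × map P (bdryPoints F) ≡ T) ×
      ((f' : Filling) (P' : Assignment d) → IsGrowth d F f' P' → map P' (bdryPoints F) ≡ T →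
        ((c : Point) → InF F c → f' c ≡ f c) × ((p : Point) → Lattice F p → P' p ≡ P p))
    oscillating⇒growth = f , P , (P-growth , map-P) , λ f' P' growth' map-P' →
      same-entry f' P' growth' map-P' ,
      Lattice⇒Corners F (λ p → P' p ≡ P p) (same-corners f' P' growth' map-P')

theorem3p3 : (d : ℕ) → 1 ≤ d → (F : List ℕ) → IsYoung F →
    ((f : Filling) (P : Assignment d) → IsGrowth d F f P →
    IsOscTableau d (bdry F) (map P (bdryPoints F)) × Avoids d F f) ×
    ((f : Filling) → Avoids d F f →
    Σ (Assignment d) λ P → IsGrowth d F f P ×
    ((P' : Assignment d) → IsGrowth d F f P' →
    (p : Point) → Lattice F p → P' p ≡ P p)) ×
    ((T : List (Vec ℕ d)) → IsOscTableau d (bdry F) T →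
    Σ Filling λ f → Σ (Assignment d) λ P →
    (IsGrowth d F f P × map P (bdryPoints F) ≡ T) ×
    ((f' : Filling) (P' : Assignment d) → IsGrowth d F f' P' →
    map P' (bdryPoints F) ≡ T →
    ((c : Point) → InF F c → f' c ≡ f c) ×
    ((p : Point) → Lattice F p → P' p ≡ P p)))
theorem3p3 (suc n) _ F young =
  (λ f P growth → growth⇒oscillating n F young f P growth , growth⇒avoids n F young f P growth) ,
  (λ f avoids → (λ (x , y) → shape (suc n) f x y) , avoids⇒growth n F young f avoids ,
     λ P' growth' (x , y) → growth≡shape n F young f P' growth' x y) ,
  λ { [] () ; (λ₀ ∷ λs) osc → oscillating⇒growth n F young λ₀ λs osc }
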